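{- Let $A,B\in\mathbb{Q}$ with $AB\neq 0$. If $x^7+Ax+B$ has reducibility type $(1,2,4)$, then, up to scaling, there are $v,w\in\mathbb{Q}$ such that $$A=w^3-v(3v+1)w^2+v(v^3+3v^2-2v+1)w-v(v^4-v^3+v^2-v+1),$$ $$B=-w\bigl(w^2-(3v^2-2v+1)w+(v^4-v^3+v^2-v+1)\bigr),$$ and $$4v^6-8v^5+9v^4-4v^3-6v^2+12v-3=\bigl(4v^3-3v^2+2v-1-2(3v-1)w\bigr)^2.$$
   Context: A monic polynomial in $\mathbb{Q}[x]$ has reducibility type $(n_1,\dots,n_k)$, $n_1\le\dots\le n_k$, if it factors as a product of $k$ irreducible polynomials in $\mathbb{Q}[x]$ (not necessarily distinct) of degrees $n_1,\dots,n_k$. Trinomials are considered up to scaling: $x^n+Ax^m+B$ and $x^n+A\lambda^{n-m}x^m+B\lambda^n$ are identified for $\lambda\in\mathbb{Q}\setminus\{0\}$; "up to scaling $(A,B)=(A_0,B_0)$" means $(A,B)=(A_0\lambda^{n-m},B_0\lambda^n)$ for some $\lambda\in\mathbb{Q}\setminus\{0\}$. -}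

module Defs where

open import Agda.Builtin.FromNat public using (Number; fromNat)
open import Algebra.Bundles.Raw using (RawSemiring)
import Algebra.Definitions.RawSemiring as RawSemiringDefinitions
open import Data.List.Base using (List; []; _∷_; _++_; foldr; map; replicate)
open import Data.List.Relation.Binary.Pointwise using (Pointwise)
open import Data.List.Relation.Unary.Linked using (Linked)
open import Data.Nat.Base as ℕ using (ℕ; zero; suc)
import Data.Nat.Literals as ℕLiterals
open import Data.Product.Base using (_×_; ∃-syntax)
open import Data.Rational.Base as ℚ using (ℚ; 0ℚ; 1ℚ)
import Data.Rational.Literals as ℚLiterals
open import Data.Unit.Base using (⊤; tt)
open import Level using (0ℓ)
open import Relation.Binary.PropositionalEquality.Core using (_≡_; _≢_)

instance
  ℕ-number : Number ℕ
  ℕ-number = ℕLiterals.number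

  ℚ-number : Number ℚ
  ℚ-number = ℚLiterals.number

  literal-constraint : ⊤
  literal-constraint = tt

open RawSemiringDefinitions ℚ.+-*-rawSemiring public using (_^_)

-- A polynomial in ℚ[x] is its list of coefficients, constant term first.
-- Trailing zeros are allowed, so equality in ℚ[x] is _≈ₚ_, not _≡_.

Poly : Set
Poly = List ℚ

coeff : Poly → ℕ → ℚ
coeff []      _       = 0ℚ
coeff (a ∷ p) zero    = a
coeff (a ∷ p) (suc i) = coeff p i

infix 4 _≈ₚ_
_≈ₚ_ : Poly → Poly → Set
p ≈ₚ q = ∀ i → coeff p i ≡ coeff q i

infixl 6 _+ₚ_
_+ₚ_ : Poly → Poly → Poly
[]      +ₚ q       = q
(a ∷ p) +ₚ []      = a ∷ p
(a ∷ p) +ₚ (b ∷ q) = (a ℚ.+ b) ∷ (p +ₚ q)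

-- (a + x p) q = a q + x (p q)
infixl 7 _*ₚ_
_*ₚ_ : Poly → Poly → Poly
[]      *ₚ q = []
(a ∷ p) *ₚ q = map (a ℚ.*_) q +ₚ (0ℚ ∷ p *ₚ q)

ℚ[x] : RawSemiring 0ℓ 0ℓ
ℚ[x] = record
  { Carrier = Poly
  ; _≈_     = _≈ₚ_
  ; _+_     = _+ₚ_
  ; _*_     = _*ₚ_
  ; 0#      = []
  ; 1#      = 1ℚ ∷ []
  }

-- The library's irreducibility: not a unit, and in every factorisation one
-- factor is a unit.  (The zero polynomial is excluded, since 0 = 0 · 0.)
open RawSemiringDefinitions ℚ[x] public using (Irreducible)

monomial : ℚ → ℕ → Poly
monomial c n = replicate n 0ℚ ++ (c ∷ [])

-- x ^ n + A x ^ m + B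
trinomial : ℕ → ℕ → ℚ → ℚ → Poly
trinomial n m A B = monomial 1ℚ n +ₚ monomial A m +ₚ monomial B 0

HasDegree : Poly → ℕ → Set
HasDegree p n = coeff p n ≢ 0ℚ × (∀ i → n ℕ.< i → coeff p i ≡ 0ℚ)

Monic : Poly → Set
Monic p = ∃[ n ] (HasDegree p n × coeff p n ≡ 1ℚ)

productₚ : List Poly → Poly
productₚ = foldr _*ₚ_ (1ℚ ∷ [])

record HasReducibilityType (p : Poly) (ns : List ℕ) : Set where
  field
    monic               : Monic p
    nondecreasing       : Linked ℕ._≤_ ns
    factors             : List Poly
    factors-irreducible : Pointwise (λ f n → Irreducible f × HasDegree f n) factors ns
    factorisation       : p ≈ₚ productₚ factors

-- (A , B) = (A₀ , B₀) up to scaling of x ^ n + A x ^ m + B; meant for m ≤ n,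
-- where the truncated difference n ∸ m is the true one.
EqualUpToScaling : (n m : ℕ) (A B A₀ B₀ : ℚ) → Set
EqualUpToScaling n m A B A₀ B₀ =
  ∃[ r ] (r ≢ 0ℚ × A ≡ A₀ ℚ.* r ^ (n ℕ.∸ m) × B ≡ B₀ ℚ.* r ^ n)

{-# OPTIONS --safe #-}

-- Scale the root r of the linear factor to 1, so that the factors of degree 1
-- and 2 become x − 1 and x² + v x + w.  The coefficients of x⁶, x⁵, x⁴, x³
-- determine the quartic factor, those of x and 1 are the formulas for A and B,
-- and the vanishing of the coefficient of x² is a quadratic equation for w.  Its
-- discriminant is the left side of the last equation, and the discriminant of
-- α w² + β w + γ = 0 is (β + 2 α w)².

module Submission where

open import Defs
open import Algebra.Apartness.Properties.HeytingCommutativeRing using (x#0y#0→xy#0)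
open import Algebra.Properties.Group using (⁻¹-involutive)
open import Data.List.Base using ([]; _∷_; drop; map)
open import Data.List.Relation.Binary.Pointwise using ([]; _∷_)
open import Data.Nat.Base as ℕ using (ℕ; zero; suc; z<s; s<s)
open import Data.Product.Base using (_×_; ∃-syntax; _,_)
open import Data.Rational.Base using (ℚ; 0ℚ; 1ℚ; _+_; _-_; _*_; -_; 1/_; ≢-nonZero)
open import Data.Rational.Properties
open import Data.Rational.Solver using (module +-*-Solver)
open import Relation.Binary.PropositionalEquality using (_≡_; _≢_; refl; sym; trans; cong; cong₂; module ≡-Reasoning)
open +-*-Solver

-- Coefficients of sums and products of polynomials.

coeff-+ₚ : ∀ p q i → coeff (p +ₚ q) i ≡ coeff p i + coeff q i
coeff-+ₚ []      q       i       = sym (+-identityˡ (coeff q i))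
coeff-+ₚ (a ∷ p) []      i       = sym (+-identityʳ (coeff (a ∷ p) i))
coeff-+ₚ (a ∷ p) (b ∷ q) zero    = refl
coeff-+ₚ (a ∷ p) (b ∷ q) (suc i) = coeff-+ₚ p q i

coeff-scale : ∀ a p i → coeff (map (a *_) p) i ≡ a * coeff p i
coeff-scale a []      i       = sym (*-zeroʳ a)
coeff-scale a (b ∷ p) zero    = refl
coeff-scale a (b ∷ p) (suc i) = coeff-scale a p i

coeff-drop : ∀ p i → coeff (drop 1 p) i ≡ coeff p (suc i)
coeff-drop []      i = refl
coeff-drop (a ∷ p) i = refl

coeff-*ₚ-zero : ∀ p q → coeff (p *ₚ q) 0 ≡ coeff p 0 * coeff q 0
coeff-*ₚ-zero []      q = sym (*-zeroˡ (coeff q 0))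
coeff-*ₚ-zero (a ∷ p) q = begin
  coeff (map (a *_) q +ₚ (0ℚ ∷ p *ₚ q)) 0 ≡⟨ coeff-+ₚ (map (a *_) q) _ 0 ⟩
  coeff (map (a *_) q) 0 + 0ℚ             ≡⟨ +-identityʳ _ ⟩
  coeff (map (a *_) q) 0                  ≡⟨ coeff-scale a q 0 ⟩
  a * coeff q 0                           ∎
  where open ≡-Reasoning

-- Split p into its constant term and x times `drop 1 p`. With `drop` in place of a pattern, the
-- rule also applies to a polynomial that is not given in constructor form.
coeff-*ₚ-suc : ∀ p q i →
  coeff (p *ₚ q) (suc i) ≡ coeff p 0 * coeff q (suc i) + coeff (drop 1 p *ₚ q) i
coeff-*ₚ-suc []      q i = sym (trans (+-identityʳ _) (*-zeroˡ (coeff q (suc i))))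
coeff-*ₚ-suc (a ∷ p) q i = trans
  (coeff-+ₚ (map (a *_) q) (0ℚ ∷ p *ₚ q) (suc i))
  (cong (_+ coeff (p *ₚ q) i) (coeff-scale a q (suc i)))

*ₚ-identityʳ : ∀ p → p *ₚ (1ℚ ∷ []) ≈ₚ p
*ₚ-identityʳ []      i       = refl
*ₚ-identityʳ (a ∷ p) zero    = trans (+-identityʳ (a * 1ℚ)) (*-identityʳ a)
*ₚ-identityʳ (a ∷ p) (suc i) = *ₚ-identityʳ p i

-- A zero polynomial may be a nonempty list of zeros, so this is not definitional. The induction is
-- on the index, and `drop 1 p` is again zero.
*ₚ-zeroˡ : ∀ p q → p ≈ₚ [] → p *ₚ q ≈ₚ []
*ₚ-zeroˡ p q p≈0 zero = begin
  coeff (p *ₚ q) 0      ≡⟨ coeff-*ₚ-zero p q ⟩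
  coeff p 0 * coeff q 0 ≡⟨ cong (_* coeff q 0) (p≈0 0) ⟩
  0ℚ * coeff q 0        ≡⟨ *-zeroˡ (coeff q 0) ⟩
  0ℚ                    ∎
  where open ≡-Reasoning
*ₚ-zeroˡ p q p≈0 (suc i) = begin
  coeff (p *ₚ q) (suc i)
    ≡⟨ coeff-*ₚ-suc p q i ⟩
  coeff p 0 * coeff q (suc i) + coeff (drop 1 p *ₚ q) i
    ≡⟨ cong₂ (λ x y → x * coeff q (suc i) + y) (p≈0 0)
         (*ₚ-zeroˡ (drop 1 p) q (λ j → trans (coeff-drop p j) (p≈0 (suc j))) i) ⟩
  0ℚ * coeff q (suc i) + 0ℚ
    ≡⟨ trans (+-identityʳ _) (*-zeroˡ (coeff q (suc i))) ⟩
  0ℚ ∎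
  where open ≡-Reasoning

-- Degree bounds are stated through vanishing coefficients because trailing zeros hide the degree
-- from the list. This is the bottom of a ladder: `drop 1` lowers the bound by one, so the quadratic
-- case reduces to the linear one and that to this one.
coeff-*ₚ-const : ∀ p q → (∀ i → 0 ℕ.< i → coeff p i ≡ 0ℚ) →
  ∀ i → coeff (p *ₚ q) i ≡ coeff p 0 * coeff q i
coeff-*ₚ-const p q p-const zero    = coeff-*ₚ-zero p q
coeff-*ₚ-const p q p-const (suc i) = begin
  coeff (p *ₚ q) (suc i)
    ≡⟨ coeff-*ₚ-suc p q i ⟩
  coeff p 0 * coeff q (suc i) + coeff (drop 1 p *ₚ q) i
    ≡⟨ cong (coeff p 0 * coeff q (suc i) +_)
         (*ₚ-zeroˡ (drop 1 p) q (λ j → trans (coeff-drop p j) (p-const (suc j) z<s)) i) ⟩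
  coeff p 0 * coeff q (suc i) + 0ℚ
    ≡⟨ +-identityʳ _ ⟩
  coeff p 0 * coeff q (suc i) ∎
  where open ≡-Reasoning

coeff-*ₚ-linear : ∀ p q → (∀ i → 1 ℕ.< i → coeff p i ≡ 0ℚ) →
  ∀ i → coeff (p *ₚ q) (suc i) ≡ coeff p 0 * coeff q (suc i) + coeff p 1 * coeff q i
coeff-*ₚ-linear p q p-linear i = trans (coeff-*ₚ-suc p q i)
  (cong (coeff p 0 * coeff q (suc i) +_) (trans
    (coeff-*ₚ-const (drop 1 p) q
      (λ j 0<j → trans (coeff-drop p j) (p-linear (suc j) (s<s 0<j))) i)
    (cong (_* coeff q i) (coeff-drop p 0))))

-- Supplies the index just below the range of `coeff-*ₚ-quadratic`.
coeff-*ₚ-one : ∀ p q →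
  coeff (p *ₚ q) 1 ≡ coeff p 0 * coeff q 1 + coeff p 1 * coeff q 0
coeff-*ₚ-one p q = trans (coeff-*ₚ-suc p q 0)
  (cong (coeff p 0 * coeff q 1 +_) (trans
    (coeff-*ₚ-zero (drop 1 p) q)
    (cong (_* coeff q 0) (coeff-drop p 0))))

coeff-*ₚ-quadratic : ∀ p q → (∀ i → 2 ℕ.< i → coeff p i ≡ 0ℚ) →
  ∀ i → coeff (p *ₚ q) (suc (suc i))
    ≡ coeff p 0 * coeff q (suc (suc i))
      + (coeff p 1 * coeff q (suc i) + coeff p 2 * coeff q i)
coeff-*ₚ-quadratic p q p-quadratic i = trans (coeff-*ₚ-suc p q (suc i))
  (cong (coeff p 0 * coeff q (suc (suc i)) +_) (trans
    (coeff-*ₚ-linear (drop 1 p) q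
      (λ j 1<j → trans (coeff-drop p j) (p-quadratic (suc j) (s<s 1<j))) i)
    (cong₂ (λ x y → x * coeff q (suc i) + y * coeff q i)
      (coeff-drop p 0) (coeff-drop p 1))))

-- Arithmetic in ℚ and the discriminant identity.

*-cancelˡ-≢0 : ∀ x {y} → x ≢ 0ℚ → x * y ≡ 0ℚ → y ≡ 0ℚ
*-cancelˡ-≢0 x {y} x≢0 xy≡0 = begin
  y              ≡⟨ *-identityˡ y ⟨
  1ℚ * y         ≡⟨ cong (_* y) (*-inverseˡ x) ⟨
  1/ x * x * y   ≡⟨ *-assoc (1/ x) x y ⟩
  1/ x * (x * y) ≡⟨ cong (1/ x *_) xy≡0 ⟩
  1/ x * 0ℚ      ≡⟨ *-zeroʳ (1/ x) ⟩
  0ℚ             ∎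
  where
  open ≡-Reasoning
  instance _ = ≢-nonZero x≢0

^-≢0 : ∀ {x} n → x ≢ 0ℚ → x ^ n ≢ 0ℚ
^-≢0 zero    x≢0 ()
^-≢0 (suc n) x≢0 = x#0y#0→xy#0 heytingCommutativeRing x≢0 (^-≢0 n x≢0)

divide : ∀ x y → y ≢ 0ℚ → ∃[ z ] x ≡ y * z
divide x y y≢0 = 1/ y * x , (begin
  x              ≡⟨ *-identityˡ x ⟨
  1ℚ * x         ≡⟨ cong (_* x) (*-inverseʳ y) ⟨
  y * 1/ y * x   ≡⟨ *-assoc y (1/ y) x ⟩
  y * (1/ y * x) ∎)
  where
  open ≡-Reasoning
  instance _ = ≢-nonZero y≢0

x+y≡z⇒x≡z-y : ∀ {x y z} → x + y ≡ z → x ≡ z - y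
x+y≡z⇒x≡z-y {x} {y} refl =
  solve 2 (λ x y → x := x :+ y :- y) (λ {_} {_} → refl) x y

x+y*0≡x : ∀ {x} y {z} → z ≡ 0ℚ → x + y * z ≡ x
x+y*0≡x {x} y refl = trans (cong (x +_) (*-zeroʳ y)) (+-identityʳ x)

-- This is β² - 4αγ = (β + 2αw)² - 4α(αw² + βw + γ) with α = 1 - 3v, β = 4v³ - 3v² + 2v - 1 and γ =
-- -(v⁵ - v⁴ + v³ - v² + v - 1). Nothing is divided by α, so v = 1/3 is no exception.
discriminant : ∀ v w →
  4 * v ^ 6 - 8 * v ^ 5 + 9 * v ^ 4 - 4 * v ^ 3 - 6 * v ^ 2 + 12 * v - 3
  ≡ (4 * v ^ 3 - 3 * v ^ 2 + 2 * v - 1 - 2 * (3 * v - 1) * w) ^ 2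
    + 4 * (3 * v - 1) * ((1 - 3 * v) * w ^ 2 + (4 * v ^ 3 - 3 * v ^ 2 + 2 * v - 1) * w
      - (v ^ 5 - v ^ 4 + v ^ 3 - v ^ 2 + v - 1))
discriminant = solve 2 (λ v w →
  con 4 :* v :^ 6 :- con 8 :* v :^ 5 :+ con 9 :* v :^ 4 :- con 4 :* v :^ 3
    :- con 6 :* v :^ 2 :+ con 12 :* v :- con 3
  := (con 4 :* v :^ 3 :- con 3 :* v :^ 2 :+ con 2 :* v :- con 1
      :- con 2 :* (con 3 :* v :- con 1) :* w) :^ 2
    :+ con 4 :* (con 3 :* v :- con 1) :* ((con 1 :- con 3 :* v) :* w :^ 2
      :+ (con 4 :* v :^ 3 :- con 3 :* v :^ 2 :+ con 2 :* v :- con 1) :* w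
      :- (v :^ 5 :- v :^ 4 :+ v :^ 3 :- v :^ 2 :+ v :- con 1)))
  (λ {_} {_} → refl)

-- Each identity below is one coefficient of (a₀ + a x)(b₀ + b₁ x + b x²) Σ cᵢ xⁱ,
-- where the first two factors are a b (x − r)(x² + r v x + r² w)
-- = a b (x³ + r (v − 1) x² + r² (w − v) x − r³ w).
module Expansion {a₀ b₀ b₁ : ℚ} (a b r v w : ℚ)
  (a₀-eq : a₀ ≡ - (a * r)) (b₁-eq : b₁ ≡ b * r * v) (b₀-eq : b₀ ≡ b * r ^ 2 * w)
  where

  expand₀ : ∀ c₀ → a₀ * (b₀ * c₀) ≡ - (r ^ 3 * w) * (a * b * c₀)
  expand₀ c₀ rewrite a₀-eq | b₀-eq = solve 6 (λ a b r v w c₀ →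
    (:- (a :* r)) :* (b :* r :^ 2 :* w :* c₀) := (:- (r :^ 3 :* w)) :* (a :* b :* c₀))
    (λ {_} {_} {_} {_} {_} {_} → refl) a b r v w c₀

  expand₁ : ∀ c₀ c₁ →
    a₀ * (b₀ * c₁ + b₁ * c₀) + a * (b₀ * c₀)
    ≡ r ^ 2 * (w - v) * (a * b * c₀) + - (r ^ 3 * w) * (a * b * c₁)
  expand₁ c₀ c₁ rewrite a₀-eq | b₁-eq | b₀-eq = solve 7 (λ a b r v w c₀ c₁ →
    (:- (a :* r)) :* (b :* r :^ 2 :* w :* c₁ :+ b :* r :* v :* c₀)
      :+ a :* (b :* r :^ 2 :* w :* c₀)
    := r :^ 2 :* (w :- v) :* (a :* b :* c₀) :+ (:- (r :^ 3 :* w)) :* (a :* b :* c₁))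
    (λ {_} {_} {_} {_} {_} {_} {_} → refl) a b r v w c₀ c₁

  expand₂ : ∀ c₀ c₁ c₂ →
    a₀ * (b₀ * c₂ + (b₁ * c₁ + b * c₀)) + a * (b₀ * c₁ + b₁ * c₀)
    ≡ r * (v - 1) * (a * b * c₀) + r ^ 2 * (w - v) * (a * b * c₁)
      + - (r ^ 3 * w) * (a * b * c₂)
  expand₂ c₀ c₁ c₂ rewrite a₀-eq | b₁-eq | b₀-eq = solve 8 (λ a b r v w c₀ c₁ c₂ →
    (:- (a :* r)) :* (b :* r :^ 2 :* w :* c₂ :+ (b :* r :* v :* c₁ :+ b :* c₀))
      :+ a :* (b :* r :^ 2 :* w :* c₁ :+ b :* r :* v :* c₀)
    := r :* (v :- con 1) :* (a :* b :* c₀) :+ r :^ 2 :* (w :- v) :* (a :* b :* c₁)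
      :+ (:- (r :^ 3 :* w)) :* (a :* b :* c₂))
    (λ {_} {_} {_} {_} {_} {_} {_} {_} → refl) a b r v w c₀ c₁ c₂

  expand₃ : ∀ c₀ c₁ c₂ c₃ →
    a₀ * (b₀ * c₃ + (b₁ * c₂ + b * c₁)) + a * (b₀ * c₂ + (b₁ * c₁ + b * c₀))
    ≡ a * b * c₀ + (r * (v - 1) * (a * b * c₁) + r ^ 2 * (w - v) * (a * b * c₂)
      + - (r ^ 3 * w) * (a * b * c₃))
  expand₃ c₀ c₁ c₂ c₃ rewrite a₀-eq | b₁-eq | b₀-eq = solve 9 (λ a b r v w c₀ c₁ c₂ c₃ →
    (:- (a :* r)) :* (b :* r :^ 2 :* w :* c₃ :+ (b :* r :* v :* c₂ :+ b :* c₁))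
      :+ a :* (b :* r :^ 2 :* w :* c₂ :+ (b :* r :* v :* c₁ :+ b :* c₀))
    := a :* b :* c₀ :+ (r :* (v :- con 1) :* (a :* b :* c₁)
      :+ r :^ 2 :* (w :- v) :* (a :* b :* c₂) :+ (:- (r :^ 3 :* w)) :* (a :* b :* c₃)))
    (λ {_} {_} {_} {_} {_} {_} {_} {_} {_} → refl) a b r v w c₀ c₁ c₂ c₃

-- Comparison of coefficients with the trinomial.

module _ (A B : ℚ) (f g h : Poly) (r v w : ℚ)
  (f-linear    : ∀ i → 1 ℕ.< i → coeff f i ≡ 0ℚ)
  (g-quadratic : ∀ i → 2 ℕ.< i → coeff g i ≡ 0ℚ)
  (h-quartic   : ∀ i → 4 ℕ.< i → coeff h i ≡ 0ℚ)
  (fgh         : trinomial 7 1 A B ≈ₚ f *ₚ (g *ₚ h))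
  (f₀ : coeff f 0 ≡ - (coeff f 1 * r))
  (g₁ : coeff g 1 ≡ coeff g 2 * r * v)
  (g₀ : coeff g 0 ≡ coeff g 2 * r ^ 2 * w)
  where

  private
    open module FactorExpansion = Expansion (coeff f 1) (coeff g 2) r v w f₀ g₁ g₀

    s t u : ℚ
    s = r * (v - 1)
    t = r ^ 2 * (w - v)
    u = - (r ^ 3 * w)

    -- The coefficients of the quotient by the monic cubic x³ + s x² + t x + u.
    d : ℕ → ℚ
    d i = coeff f 1 * coeff g 2 * coeff h i

    T : ℕ → ℚ
    T = coeff (trinomial 7 1 A B)

    d-quartic : ∀ i → 4 ℕ.< i → d i ≡ 0ℚ
    d-quartic i 4<i = trans (cong (coeff f 1 * coeff g 2 *_) (h-quartic i 4<i))
      (*-zeroʳ (coeff f 1 * coeff g 2))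

    T₀ : T 0 ≡ u * d 0
    T₀ = begin
      T 0
        ≡⟨ fgh 0 ⟩
      coeff (f *ₚ (g *ₚ h)) 0
        ≡⟨ coeff-*ₚ-zero f (g *ₚ h) ⟩
      coeff f 0 * coeff (g *ₚ h) 0
        ≡⟨ cong (coeff f 0 *_) (coeff-*ₚ-zero g h) ⟩
      coeff f 0 * (coeff g 0 * coeff h 0)
        ≡⟨ expand₀ (coeff h 0) ⟩
      u * d 0 ∎
      where open ≡-Reasoning

    -- Multiplies out the linear factor f only; x and y leave room for whichever formula for the
    -- coefficients of g h is valid at the index in question.
    T₁₊ : ∀ i {x y} → coeff (g *ₚ h) (suc i) ≡ x → coeff (g *ₚ h) i ≡ y →
      T (suc i) ≡ coeff f 0 * x + coeff f 1 * y
    T₁₊ i refl refl = trans (fgh (suc i)) (coeff-*ₚ-linear f (g *ₚ h) f-linear i)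

    T₁ : T 1 ≡ t * d 0 + u * d 1
    T₁ = trans (T₁₊ 0 (coeff-*ₚ-one g h) (coeff-*ₚ-zero g h))
      (expand₁ (coeff h 0) (coeff h 1))

    T₂ : T 2 ≡ s * d 0 + t * d 1 + u * d 2
    T₂ = trans (T₁₊ 1 (coeff-*ₚ-quadratic g h g-quadratic 0) (coeff-*ₚ-one g h))
      (expand₂ (coeff h 0) (coeff h 1) (coeff h 2))

    -- From x³ on, all four coefficients of the cubic contribute, so one formula serves x³ to x⁷.
    T₃₊ : ∀ i → T (3 ℕ.+ i) ≡ d i + (s * d (1 ℕ.+ i) + t * d (2 ℕ.+ i) + u * d (3 ℕ.+ i))
    T₃₊ i = trans
      (T₁₊ (2 ℕ.+ i) (coeff-*ₚ-quadratic g h g-quadratic (suc i))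
        (coeff-*ₚ-quadratic g h g-quadratic i))
      (expand₃ (coeff h i) (coeff h (1 ℕ.+ i)) (coeff h (2 ℕ.+ i))
        (coeff h (3 ℕ.+ i)))

    -- The cubic is monic, so `T₃₊` can be solved for `d i`. This is long division from the top,
    -- started by `d 5`, `d 6` and `d 7`, which vanish.
    d-recurrence : ∀ i {x y z} → d (1 ℕ.+ i) ≡ x → d (2 ℕ.+ i) ≡ y → d (3 ℕ.+ i) ≡ z →
      d i ≡ T (3 ℕ.+ i) - (s * x + t * y + u * z)
    d-recurrence i refl refl refl = x+y≡z⇒x≡z-y (sym (T₃₊ i))

    d₅ : d 5 ≡ 0ℚ
    d₅ = d-quartic 5 (s<s (s<s (s<s (s<s z<s))))

    d₆ : d 6 ≡ 0ℚ
    d₆ = d-quartic 6 (s<s (s<s (s<s (s<s z<s))))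

    d₇ : d 7 ≡ 0ℚ
    d₇ = d-quartic 7 (s<s (s<s (s<s (s<s z<s))))

    -- The factors need not be monic; only the product of their leading coefficients is forced to be
    -- 1. The first `con 1` is the coefficient of x⁷ in the trinomial; the first `con 0` in `d₃` to
    -- `d₀` is that of x⁶ to x³. Each step down raises the power of r by one.
    d₄ : d 4 ≡ 1
    d₄ = trans (d-recurrence 4 d₅ d₆ d₇) (solve 3 (λ r v w →
      con 1 :- (r :* (v :- con 1) :* con 0 :+ r :^ 2 :* (w :- v) :* con 0
        :+ (:- (r :^ 3 :* w)) :* con 0)
      := con 1)
      (λ {_} {_} {_} → refl) r v w)

    d₃ : d 3 ≡ r * (1 - v)
    d₃ = trans (d-recurrence 3 d₄ d₅ d₆) (solve 3 (λ r v w →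
      con 0 :- (r :* (v :- con 1) :* con 1 :+ r :^ 2 :* (w :- v) :* con 0
        :+ (:- (r :^ 3 :* w)) :* con 0)
      := r :* (con 1 :- v))
      (λ {_} {_} {_} → refl) r v w)

    d₂ : d 2 ≡ r ^ 2 * (v ^ 2 - v + 1 - w)
    d₂ = trans (d-recurrence 2 d₃ d₄ d₅) (solve 3 (λ r v w →
      con 0 :- (r :* (v :- con 1) :* (r :* (con 1 :- v)) :+ r :^ 2 :* (w :- v) :* con 1
        :+ (:- (r :^ 3 :* w)) :* con 0)
      := r :^ 2 :* (v :^ 2 :- v :+ con 1 :- w))
      (λ {_} {_} {_} → refl) r v w)

    d₁ : d 1 ≡ r ^ 3 * ((2 * v - 1) * w - (v ^ 3 - v ^ 2 + v - 1))
    d₁ = trans (d-recurrence 1 d₂ d₃ d₄) (solve 3 (λ r v w →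
      con 0 :- (r :* (v :- con 1) :* (r :^ 2 :* (v :^ 2 :- v :+ con 1 :- w))
        :+ r :^ 2 :* (w :- v) :* (r :* (con 1 :- v))
        :+ (:- (r :^ 3 :* w)) :* con 1)
      := r :^ 3 :* ((con 2 :* v :- con 1) :* w :- (v :^ 3 :- v :^ 2 :+ v :- con 1)))
      (λ {_} {_} {_} → refl) r v w)

    d₀ : d 0 ≡ r ^ 4 * (w ^ 2 - (3 * v ^ 2 - 2 * v + 1) * w
      + (v ^ 4 - v ^ 3 + v ^ 2 - v + 1))
    d₀ = trans (d-recurrence 0 d₁ d₂ d₃) (solve 3 (λ r v w →
      con 0 :- (r :* (v :- con 1)
          :* (r :^ 3 :* ((con 2 :* v :- con 1) :* w :- (v :^ 3 :- v :^ 2 :+ v :- con 1)))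
        :+ r :^ 2 :* (w :- v) :* (r :^ 2 :* (v :^ 2 :- v :+ con 1 :- w))
        :+ (:- (r :^ 3 :* w)) :* (r :* (con 1 :- v)))
      := r :^ 4 :* (w :^ 2 :- (con 3 :* v :^ 2 :- con 2 :* v :+ con 1) :* w
        :+ (v :^ 4 :- v :^ 3 :+ v :^ 2 :- v :+ con 1)))
      (λ {_} {_} {_} → refl) r v w)

  linear-coefficient : A ≡
    (w ^ 3 - v * (3 * v + 1) * w ^ 2
      + v * (v ^ 3 + 3 * v ^ 2 - 2 * v + 1) * w
      - v * (v ^ 4 - v ^ 3 + v ^ 2 - v + 1)) * r ^ 6
  linear-coefficient = begin
    A
      -- `T 1` computes to 0 + A, the 0 coming from the monomial x⁷.
      ≡⟨ +-identityˡ A ⟨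
    T 1
      ≡⟨ T₁ ⟩
    t * d 0 + u * d 1
      ≡⟨ cong₂ (λ x y → t * x + u * y) d₀ d₁ ⟩
    _
      ≡⟨ solve 3 (λ r v w →
           r :^ 2 :* (w :- v) :* (r :^ 4
             :* (w :^ 2 :- (con 3 :* v :^ 2 :- con 2 :* v :+ con 1) :* w
               :+ (v :^ 4 :- v :^ 3 :+ v :^ 2 :- v :+ con 1)))
           :+ (:- (r :^ 3 :* w)) :* (r :^ 3
             :* ((con 2 :* v :- con 1) :* w :- (v :^ 3 :- v :^ 2 :+ v :- con 1)))
           := (w :^ 3 :- v :* (con 3 :* v :+ con 1) :* w :^ 2
             :+ v :* (v :^ 3 :+ con 3 :* v :^ 2 :- con 2 :* v :+ con 1) :* w
             :- v :* (v :^ 4 :- v :^ 3 :+ v :^ 2 :- v :+ con 1)) :* r :^ 6)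
           (λ {_} {_} {_} → refl) r v w ⟩
    _ ∎
    where open ≡-Reasoning

  constant-coefficient : B ≡
    (- w * (w ^ 2 - (3 * v ^ 2 - 2 * v + 1) * w
      + (v ^ 4 - v ^ 3 + v ^ 2 - v + 1))) * r ^ 7
  constant-coefficient = begin
    B
      ≡⟨ +-identityˡ B ⟨
    T 0
      ≡⟨ T₀ ⟩
    u * d 0
      ≡⟨ cong (u *_) d₀ ⟩
    _
      ≡⟨ solve 3 (λ r v w →
           (:- (r :^ 3 :* w)) :* (r :^ 4
             :* (w :^ 2 :- (con 3 :* v :^ 2 :- con 2 :* v :+ con 1) :* w
               :+ (v :^ 4 :- v :^ 3 :+ v :^ 2 :- v :+ con 1)))
           := (:- w) :* (w :^ 2 :- (con 3 :* v :^ 2 :- con 2 :* v :+ con 1) :* w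
             :+ (v :^ 4 :- v :^ 3 :+ v :^ 2 :- v :+ con 1)) :* r :^ 7)
           (λ {_} {_} {_} → refl) r v w ⟩
    _ ∎
    where open ≡-Reasoning

  -- The trinomial has no x² term, and the coefficient of x² in the product is -r⁵ times this
  -- quadratic in w.
  quadratic-equation : r ≢ 0ℚ →
    (1 - 3 * v) * w ^ 2 + (4 * v ^ 3 - 3 * v ^ 2 + 2 * v - 1) * w
      - (v ^ 5 - v ^ 4 + v ^ 3 - v ^ 2 + v - 1) ≡ 0ℚ
  quadratic-equation r≢0 = *-cancelˡ-≢0 (r ^ 5) (^-≢0 5 r≢0) (begin
    _
      ≡⟨ solve 3 (λ r v w →
           r :^ 5 :* ((con 1 :- con 3 :* v) :* w :^ 2
             :+ (con 4 :* v :^ 3 :- con 3 :* v :^ 2 :+ con 2 :* v :- con 1) :* w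
             :- (v :^ 5 :- v :^ 4 :+ v :^ 3 :- v :^ 2 :+ v :- con 1))
           := :- (r :* (v :- con 1) :* (r :^ 4
               :* (w :^ 2 :- (con 3 :* v :^ 2 :- con 2 :* v :+ con 1) :* w
                 :+ (v :^ 4 :- v :^ 3 :+ v :^ 2 :- v :+ con 1)))
             :+ r :^ 2 :* (w :- v) :* (r :^ 3
               :* ((con 2 :* v :- con 1) :* w :- (v :^ 3 :- v :^ 2 :+ v :- con 1)))
             :+ (:- (r :^ 3 :* w)) :* (r :^ 2 :* (v :^ 2 :- v :+ con 1 :- w))))
           (λ {_} {_} {_} → refl) r v w ⟩
    - (s * _ + t * _ + u * _)
      -- The explicit polynomials are folded back into `d 0`, `d 1` and then `d 2`, so that `T₂`
      -- applies.
      ≡⟨ cong₂ (λ x y → - (s * x + t * y + u * _)) d₀ d₁ ⟨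
    - (s * d 0 + t * d 1 + u * _)
      ≡⟨ cong (λ z → - (s * d 0 + t * d 1 + u * z)) d₂ ⟨
    - (s * d 0 + t * d 1 + u * d 2)
      ≡⟨ cong -_ T₂ ⟨
    0ℚ ∎)
    where open ≡-Reasoning

  parametrisation : r ≢ 0ℚ →
    EqualUpToScaling 7 1 A B
      (w ^ 3 - v * (3 * v + 1) * w ^ 2
        + v * (v ^ 3 + 3 * v ^ 2 - 2 * v + 1) * w
        - v * (v ^ 4 - v ^ 3 + v ^ 2 - v + 1))
      (- w * (w ^ 2 - (3 * v ^ 2 - 2 * v + 1) * w
        + (v ^ 4 - v ^ 3 + v ^ 2 - v + 1)))
    × 4 * v ^ 6 - 8 * v ^ 5 + 9 * v ^ 4 - 4 * v ^ 3 - 6 * v ^ 2 + 12 * v - 3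
      ≡ (4 * v ^ 3 - 3 * v ^ 2 + 2 * v - 1 - 2 * (3 * v - 1) * w) ^ 2
  parametrisation r≢0 =
    -- The scaling factor is the root r, which enters A as r⁶ and B as r⁷.
    (r , r≢0 , linear-coefficient , constant-coefficient)
    , trans (discriminant v w) (x+y*0≡x (4 * (3 * v - 1)) (quadratic-equation r≢0))

-- Normalising the given factors.

theorem5p1 : (A B : ℚ) → A * B ≢ 0ℚ →
    HasReducibilityType (trinomial 7 1 A B) (1 ∷ 2 ∷ 4 ∷ []) →
    ∃[ v ] ∃[ w ]
    ( EqualUpToScaling 7 1 A B
    (w ^ 3 - v * (3 * v + 1) * w ^ 2
    + v * (v ^ 3 + 3 * v ^ 2 - 2 * v + 1) * w
    - v * (v ^ 4 - v ^ 3 + v ^ 2 - v + 1))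
    (- w * (w ^ 2 - (3 * v ^ 2 - 2 * v + 1) * w
    + (v ^ 4 - v ^ 3 + v ^ 2 - v + 1)))
    × 4 * v ^ 6 - 8 * v ^ 5 + 9 * v ^ 4 - 4 * v ^ 3 - 6 * v ^ 2 + 12 * v - 3
    ≡ (4 * v ^ 3 - 3 * v ^ 2 + 2 * v - 1 - 2 * (3 * v - 1) * w) ^ 2 )
theorem5p1 A B AB≢0 record
  { factors             = f ∷ g ∷ h ∷ []
  ; factors-irreducible =
      (_ , f₁≢0 , f-linear) ∷ (_ , g₂≢0 , g-quadratic) ∷ (_ , _ , h-quartic) ∷ []
  ; factorisation       = fgh
  } =
  -- `productₚ` ends in the constant polynomial 1, so the last factor appears as h times 1, with the
  -- same coefficients as h.
  let h′ = h *ₚ (1ℚ ∷ [])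

      -- The constant term of f divides B, and A B is nonzero.
      f₀≢0 : coeff f 0 ≢ 0ℚ
      f₀≢0 f₀≡0 = AB≢0 (begin
        A * B
          ≡⟨ cong (A *_) (+-identityˡ B) ⟨
        A * coeff (trinomial 7 1 A B) 0
          ≡⟨ cong (A *_) (trans (fgh 0) (coeff-*ₚ-zero f (g *ₚ h′))) ⟩
        A * (coeff f 0 * coeff (g *ₚ h′) 0)
          ≡⟨ cong (λ x → A * (x * coeff (g *ₚ h′) 0)) f₀≡0 ⟩
        A * (0ℚ * coeff (g *ₚ h′) 0)
          ≡⟨ trans (cong (A *_) (*-zeroˡ (coeff (g *ₚ h′) 0))) (*-zeroʳ A) ⟩
        0ℚ ∎)

      -- The root of f.
      r , -f₀≡f₁r = divide (- coeff f 0) (coeff f 1) f₁≢0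

      f₀≡-f₁r : coeff f 0 ≡ - (coeff f 1 * r)
      f₀≡-f₁r = trans (sym (⁻¹-involutive +-0-group (coeff f 0))) (cong -_ -f₀≡f₁r)

      r≢0 : r ≢ 0ℚ
      r≢0 r≡0 = f₀≢0 (trans f₀≡-f₁r (cong -_
        (trans (cong (coeff f 1 *_) r≡0) (*-zeroʳ (coeff f 1)))))

      -- Here v and w are the lower coefficients of g(r x) after division by its leading
      -- coefficient, `coeff g 2 * r ^ 2`.
      v , g₁≡ = divide (coeff g 1) (coeff g 2 * r)
        (x#0y#0→xy#0 heytingCommutativeRing g₂≢0 r≢0)

      w , g₀≡ = divide (coeff g 0) (coeff g 2 * r ^ 2)
        (x#0y#0→xy#0 heytingCommutativeRing g₂≢0 (^-≢0 2 r≢0))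

      h′-quartic : ∀ i → 4 ℕ.< i → coeff h′ i ≡ 0ℚ
      h′-quartic i 4<i = trans (*ₚ-identityʳ h i) (h-quartic i 4<i)
  in v , w , parametrisation A B f g h′ r v w
       f-linear g-quadratic h′-quartic fgh f₀≡-f₁r g₁≡ g₀≡ r≢0
  where open ≡-Reasoning
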